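{- For every multiplicity vector $\boldsymbol m=(m_1,\ldots,m_n)$ of nonnegative integers and every $r\geq1$, $$H_{(m_1,\ldots,m_n,r)}(x,y)=\mathcal G_r\,H_{\boldsymbol m}(x,y).$$
   Context: For a vector $\boldsymbol m=(m_1,\ldots,m_n)$ of nonnegative integers, $\mathfrak S_{\boldsymbol m}$ is the set of permutations (words) of the multiset $\{1^{m_1},2^{m_2},\ldots,n^{m_n}\}$; zero multiplicities are ignored. Let $N=m_1+\cdots+m_n$. For $\pi=\pi_1\cdots\pi_N$, $\mathrm{des}(\pi)=\#\{i\in[N-1]:\pi_i>\pi_{i+1}\}$. If the multiset is nonempty, $$H_{\boldsymbol m}(x,y)=\sum_{\pi\in\mathfrak S_{\boldsymbol m}}x^{\mathrm{des}(\pi)+1}y^{N-\mathrm{des}(\pi)},$$ and for the empty multiset $H_\varnothing(x,y)=x$. With $D=\partial_x+\partial_y$, for $r\geq1$, $\mathcal G_r=y^r\sum_{j=1}^{r}\binom{r-1}{j-1}\frac{x^j}{j!}D^j$, an operator on $\mathbb Q[x,y]$. -}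

module Defs where

open import Data.Bool.Base using (if_then_else_)
open import Data.Fin.Base using (Fin; inject₁) renaming (suc to fsuc)
open import Data.Fin.Properties using (all?) renaming (_≟_ to _≟ᶠ_; _<?_ to _<ᶠ?_)
open import Data.Fin.Subset using (∣_∣)
open import Data.Integer.Base using (+_)
open import Data.List.Base using (List; []; _∷_; [_]; _++_; map; foldr; filter;
  upTo; allFin; cartesianProductWith)
open import Data.Nat.Base using (ℕ; zero; suc; _+_; _∸_; _!)
open import Data.Nat.Combinatorics using (_C_)
open import Data.Nat.GeneralisedArithmetic using (fold)
open import Data.Nat.Properties using (_≟_; _!≢0)
open import Data.Product.Base using (_×_; _,_)
open import Data.Rational.Base as ℚ using (ℚ; 0ℚ; 1ℚ)
open import Data.Vec.Base as Vec using (Vec; lookup; count; tabulate; sum)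
open import Relation.Binary.PropositionalEquality.Core using (_≡_)
open import Relation.Nullary.Decidable.Core using (Dec; does; _×-dec_)

-- ℚ[x,y]: a polynomial is a finite formal sum of terms (c , a , b), meaning
-- c xᵃ yᵇ.  Exponent pairs may repeat and coefficients may vanish, so equality
-- of polynomials is _≈ᴾ_, not _≡_.

Term : Set
Term = ℚ × ℕ × ℕ

Poly : Set
Poly = List Term

coeff : Poly → ℕ → ℕ → ℚ
coeff []                _ _ = 0ℚ
coeff ((c , a , b) ∷ p) i j =
  (if does ((a ≟ i) ×-dec (b ≟ j)) then c else 0ℚ) ℚ.+ coeff p i j

infix 4 _≈ᴾ_

_≈ᴾ_ : Poly → Poly → Set
p ≈ᴾ q = ∀ i j → coeff p i j ≡ coeff q i j

infixl 6 _+ᴾ_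
infixl 7 _*ᴾ_
infixr 8 _^ᴾ_

0ᴾ 1ᴾ X Y : Poly
0ᴾ = []
1ᴾ = [ (1ℚ , 0 , 0) ]
X  = [ (1ℚ , 1 , 0) ]
Y  = [ (1ℚ , 0 , 1) ]

constᴾ : ℚ → Poly
constᴾ c = [ (c , 0 , 0) ]

_+ᴾ_ : Poly → Poly → Poly
_+ᴾ_ = _++_

_*ᵗ_ : Term → Term → Term
(c , a , b) *ᵗ (c′ , a′ , b′) = (c ℚ.* c′ , a + a′ , b + b′)

_*ᴾ_ : Poly → Poly → Poly
_*ᴾ_ = cartesianProductWith _*ᵗ_

_^ᴾ_ : Poly → ℕ → Poly
p ^ᴾ zero  = 1ᴾ
p ^ᴾ suc k = p *ᴾ p ^ᴾ k

∑ : {A : Set} → List A → (A → Poly) → Poly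
∑ as f = foldr (λ a p → f a +ᴾ p) 0ᴾ as

-- The truncation at exponent 0 is harmless: the coefficient is then 0.
∂x ∂y : Poly → Poly
∂x = map λ (c , a , b) → (c ℚ.* (+ a ℚ./ 1) , a ∸ 1 , b)
∂y = map λ (c , a , b) → (c ℚ.* (+ b ℚ./ 1) , a , b ∸ 1)

D : Poly → Poly
D p = ∂x p +ᴾ ∂y p

-- The summation index i is j - 1, so j runs over 1, …, r.
𝒢 : ℕ → Poly → Poly
𝒢 r p = Y ^ᴾ r *ᴾ ∑ (upTo r) λ i → let j = suc i in
  constᴾ ((+ ((r ∸ 1) C (j ∸ 1)) ℚ./ (j !)) {{ j !≢0 }}) *ᴾ X ^ᴾ j *ᴾ fold p D j

-- Words of length N; the letter i : Fin n stands for toℕ i + 1.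

Word : ℕ → ℕ → Set
Word n N = Vec (Fin n) N

allWords : ∀ n N → List (Word n N)
allWords n zero    = [ Vec.[] ]
allWords n (suc N) = cartesianProductWith Vec._∷_ (allFin n) (allWords n N)

IsPermutationOf : ∀ {n N} → Vec ℕ n → Word n N → Set
IsPermutationOf m π = ∀ i → count (i ≟ᶠ_) π ≡ lookup m i

isPermutationOf? : ∀ {n N} (m : Vec ℕ n) (π : Word n N) → Dec (IsPermutationOf m π)
isPermutationOf? m π = all? λ i → count (i ≟ᶠ_) π ≟ lookup m i

𝔖 : ∀ {n} (m : Vec ℕ n) → List (Word n (sum m))
𝔖 {n} m = filter (isPermutationOf? m) (allWords n (sum m))

des : ∀ {n N} → Word n N → ℕ
des {N = zero}  π = 0
des {N = suc k} π =
  ∣ tabulate {n = k} (λ i → does (lookup π (fsuc i) <ᶠ? lookup π (inject₁ i))) ∣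

H : ∀ {n} → Vec ℕ n → Poly
H m = if does (sum m ≟ 0)
  then X
  else ∑ (𝔖 m) λ π → X ^ᴾ (des π + 1) *ᴾ Y ^ᴾ (sum m ∸ des π)

{-# OPTIONS --safe #-}

-- A word π of length N with d descents has N + 1 gaps.  Putting copies of a new
-- top letter into a gap creates no descent if the gap is one of the d descents
-- or the end (a free gap), and exactly one descent otherwise (a costly gap), so
-- the monomial x^(d+1) y^(N-d) of π counts its free gaps by x and its costly
-- gaps by y.  Applying Dʲ / j! to it selects the j gaps that receive letters,
-- the factor xʲ yʳ restores the exponents, and (r-1) C (j-1) counts the ways to
-- share the r letters among the selected gaps.  The count of insertions and this
-- closed form are compared through common recurrences, obtained by deciding
-- whether the first gap receives a letter.

module Submission where

open import Defs
open import Algebra.Bundles using (CommutativeMonoid)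
open import Algebra.Properties.CommutativeSemigroup using (interchange)
open import Data.Bool.Base using (true; false; if_then_else_)
open import Data.Fin.Base as Fin using (Fin; toℕ; fromℕ; inject₁)
  renaming (zero to fzero; suc to fsuc)
open import Data.Fin.Properties using (toℕ-inject₁; toℕ-fromℕ; inject₁ℕ<; fromℕ≢inject₁;
  inject₁-injective; ≤fromℕ)
  renaming (_≟_ to _≟ᶠ_; _<?_ to _<ᶠ?_)
open import Data.Fin.Relation.Unary.Top using (view; ‵fromℕ; ‵inject₁)
open import Data.Fin.Subset using (Subset; ∣_∣)
open import Data.Fin.Subset.Properties using (∣p∣≤n)
open import Data.Integer.Base as ℤ using ()
import Data.Integer.Properties as ℤ
open import Data.List.Base as List using (List; []; _∷_; _++_; map; filter; upTo; allFin;
  cartesianProductWith)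
open import Data.List.Properties using (map-upTo; map-tabulate; upTo-∷ʳ)
open import Data.Nat.Base as ℕ using (ℕ; zero; suc; _∸_; _!; _≤_; s≤s; z≤n)
open import Data.Nat.Combinatorics using (_C_; nCk+nC[k+1]≡[n+1]C[k+1]; k>n⇒nCk≡0)
open import Data.Nat.GeneralisedArithmetic using (fold)
open import Data.Nat.Properties as ℕ using (_≟_; _!≢0)
open import Data.Product.Base using (_,_)
open import Data.Rational.Base as ℚ using (ℚ; 0ℚ; 1ℚ; _+_; _*_)
open import Data.Rational.Properties using (toℚᵘ-injective; toℚᵘ-fromℚᵘ; toℚᵘ-homo-+; toℚᵘ-homo-*;
  +-0-commutativeMonoid; +-identityˡ; +-identityʳ; +-assoc; +-comm; *-identityˡ; *-identityʳ;
  *-zeroˡ; *-zeroʳ; *-assoc; *-distribˡ-+; *-distribʳ-+)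
open import Data.Rational.Solver using (module +-*-Solver)
import Data.Rational.Unnormalised.Base as ℚᵘ
import Data.Rational.Unnormalised.Properties as ℚᵘ
open import Data.Vec.Base as Vec using (Vec; []; _∷_; _∷ʳ_; lookup; count; sum; tabulate)
open import Data.Vec.Properties using (count≤n)
open import Function.Base using (_∘_; id)
open import Function.Bundles using (mk⇔)
open import Relation.Binary.PropositionalEquality
open import Relation.Nullary using (yes; no; does; ¬_; contradiction; Dec; _×-dec_)
open import Relation.Nullary.Decidable using (dec-true; dec-false; does-⇔)
open +-*-Solver using (solve; _:+_; _:*_; _:=_)
open ≡-Reasoning

-- Natural numbers inside the rationals

ι : ℕ → ℚ
ι n = ℤ.+ n ℚ./ 1

ι-+ : ∀ m n → ι (m ℕ.+ n) ≡ ι m + ι n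
ι-+ m n = toℚᵘ-injective (ℚᵘ.≃-trans (toℚᵘ-fromℚᵘ (ℚᵘ.mkℚᵘ (ℤ.+ (m ℕ.+ n)) 0)) (ℚᵘ.≃-sym
  (ℚᵘ.≃-trans (toℚᵘ-homo-+ (ι m) (ι n)) (ℚᵘ.≃-trans
    (ℚᵘ.+-cong (toℚᵘ-fromℚᵘ (ℚᵘ.mkℚᵘ (ℤ.+ m) 0)) (toℚᵘ-fromℚᵘ (ℚᵘ.mkℚᵘ (ℤ.+ n) 0)))
    (ℚᵘ.*≡* (cong (ℤ._* ℤ.+ 1) (cong₂ ℤ._+_ (ℤ.*-identityʳ (ℤ.+ m)) (ℤ.*-identityʳ (ℤ.+ n)))))))))

-- At `n = 1` and `d = j !` this clears the denominator in `𝒢`; at `d = 1` it makes `ι`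
-- multiplicative.
/-*-cancel : ∀ m n d .{{_ : ℕ.NonZero d}} → (ℤ.+ m ℚ./ d) * ι (n ℕ.* d) ≡ ι (m ℕ.* n)
/-*-cancel m n (suc d) = toℚᵘ-injective (ℚᵘ.≃-trans
  (toℚᵘ-homo-* (ℤ.+ m ℚ./ suc d) (ι (n ℕ.* suc d))) (ℚᵘ.≃-trans
    (ℚᵘ.*-cong (toℚᵘ-fromℚᵘ (ℚᵘ.mkℚᵘ (ℤ.+ m) d)) (toℚᵘ-fromℚᵘ (ℚᵘ.mkℚᵘ (ℤ.+ (n ℕ.* suc d)) 0)))
    (ℚᵘ.≃-trans (ℚᵘ.*≡* lemma)
    (ℚᵘ.≃-sym (toℚᵘ-fromℚᵘ (ℚᵘ.mkℚᵘ (ℤ.+ (m ℕ.* n)) 0))))))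
  where
  lemma : (ℤ.+ m ℤ.* ℤ.+ (n ℕ.* suc d)) ℤ.* ℤ.+ 1 ≡ ℤ.+ (m ℕ.* n) ℤ.* ℤ.+ (suc d ℕ.* 1)
  lemma = begin
    (ℤ.+ m ℤ.* ℤ.+ (n ℕ.* suc d)) ℤ.* ℤ.+ 1  ≡⟨ ℤ.*-identityʳ _ ⟩
    ℤ.+ m ℤ.* ℤ.+ (n ℕ.* suc d)            ≡⟨ ℤ.pos-* m _ ⟨
    ℤ.+ (m ℕ.* (n ℕ.* suc d))            ≡⟨ cong ℤ.+_ (ℕ.*-assoc m n (suc d)) ⟨
    ℤ.+ ((m ℕ.* n) ℕ.* suc d)            ≡⟨ cong (λ k → ℤ.+ ((m ℕ.* n) ℕ.* k)) (ℕ.*-identityʳ (suc d)) ⟨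
    ℤ.+ ((m ℕ.* n) ℕ.* (suc d ℕ.* 1))    ≡⟨ ℤ.pos-* (m ℕ.* n) _ ⟩
    ℤ.+ (m ℕ.* n) ℤ.* ℤ.+ (suc d ℕ.* 1)    ∎

ι-* : ∀ m n → ι (m ℕ.* n) ≡ ι m * ι n
ι-* m n = trans (sym (/-*-cancel m n 1)) (cong (λ k → ι m * ι k) (ℕ.*-identityʳ n))

+-interchange : ∀ a b c d → (a + b) + (c + d) ≡ (a + c) + (b + d)
+-interchange = interchange (CommutativeMonoid.commutativeSemigroup +-0-commutativeMonoid)

-- Finite sums

private variable A B E : Set

∑ℚ : List A → (A → ℚ) → ℚ
∑ℚ []       f = 0ℚ
∑ℚ (a ∷ as) f = f a + ∑ℚ as f

∑-cong : ∀ (as : List A) {f g : A → ℚ} → (∀ a → f a ≡ g a) → ∑ℚ as f ≡ ∑ℚ as g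
∑-cong []       eq = refl
∑-cong (a ∷ as) eq = cong₂ _+_ (eq a) (∑-cong as eq)

∑-zero : ∀ (as : List A) {f : A → ℚ} → (∀ a → f a ≡ 0ℚ) → ∑ℚ as f ≡ 0ℚ
∑-zero []       eq = refl
∑-zero (a ∷ as) eq = cong₂ _+_ (eq a) (∑-zero as eq)

∑-+ : ∀ (as : List A) (f g : A → ℚ) → ∑ℚ as (λ a → f a + g a) ≡ ∑ℚ as f + ∑ℚ as g
∑-+ []       f g = refl
∑-+ (a ∷ as) f g = trans (cong ((f a + g a) +_) (∑-+ as f g)) (+-interchange (f a) (g a) (∑ℚ as f) (∑ℚ as g))

∑-*ˡ : ∀ (as : List A) c (f : A → ℚ) → ∑ℚ as (λ a → c * f a) ≡ c * ∑ℚ as f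
∑-*ˡ []       c f = sym (*-zeroʳ c)
∑-*ˡ (a ∷ as) c f = trans (cong (c * f a +_) (∑-*ˡ as c f)) (sym (*-distribˡ-+ c _ _))

∑-++ : ∀ (as bs : List A) (f : A → ℚ) → ∑ℚ (as ++ bs) f ≡ ∑ℚ as f + ∑ℚ bs f
∑-++ []       bs f = sym (+-identityˡ _)
∑-++ (a ∷ as) bs f = trans (cong (f a +_) (∑-++ as bs f)) (sym (+-assoc (f a) _ _))

∑-map : ∀ (h : B → A) (bs : List B) (f : A → ℚ) → ∑ℚ (map h bs) f ≡ ∑ℚ bs (f ∘ h)
∑-map h []       f = refl
∑-map h (b ∷ bs) f = cong (f (h b) +_) (∑-map h bs f)

∑-swap : ∀ (as : List A) (bs : List B) (f : A → B → ℚ) →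
  ∑ℚ as (λ a → ∑ℚ bs (f a)) ≡ ∑ℚ bs (λ b → ∑ℚ as (λ a → f a b))
∑-swap []       bs f = sym (∑-zero bs (λ _ → refl))
∑-swap (a ∷ as) bs f =
  trans (cong (∑ℚ bs (f a) +_) (∑-swap as bs f)) (sym (∑-+ bs (f a) _))

∑-cartesianProductWith : ∀ (h : A → B → E) (as : List A) (bs : List B) (f : E → ℚ) →
  ∑ℚ (cartesianProductWith h as bs) f ≡ ∑ℚ as (λ a → ∑ℚ bs (λ b → f (h a b)))
∑-cartesianProductWith h []       bs f = refl
∑-cartesianProductWith h (a ∷ as) bs f = trans (∑-++ (map (h a) bs) _ f)
  (cong₂ _+_ (∑-map (h a) bs f) (∑-cartesianProductWith h as bs f))

∑-filter : ∀ {P : A → Set} (P? : ∀ a → Dec (P a)) (as : List A) (f : A → ℚ) →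
  ∑ℚ (filter P? as) f ≡ ∑ℚ as (λ a → if does (P? a) then f a else 0ℚ)
∑-filter P? []       f = refl
∑-filter P? (a ∷ as) f with does (P? a)
... | true  = cong (f a +_) (∑-filter P? as f)
... | false = trans (∑-filter P? as f) (sym (+-identityˡ _))

∑-allFin-last : ∀ n (f : Fin (suc n) → ℚ) →
  ∑ℚ (allFin (suc n)) f ≡ ∑ℚ (allFin n) (f ∘ inject₁) + f (fromℕ n)
∑-allFin-last n f = trans (last n id)
  (cong (_+ f (fromℕ n)) (trans
    (cong (λ as → ∑ℚ as f) (sym (map-tabulate {n = n} id inject₁)))
    (∑-map inject₁ (allFin n) f)))
  where
  last : ∀ k (h : Fin (suc k) → Fin (suc n)) →
    ∑ℚ (List.tabulate h) f ≡ ∑ℚ (List.tabulate (h ∘ inject₁)) f + f (h (fromℕ k))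
  last zero    h = +-comm (f (h fzero)) 0ℚ
  last (suc k) h = trans (cong (f (h fzero) +_) (last k (h ∘ fsuc))) (sym (+-assoc (f (h fzero)) _ _))

∑-upTo-suc : ∀ n (f : ℕ → ℚ) → ∑ℚ (upTo (suc n)) f ≡ f 0 + ∑ℚ (upTo n) (f ∘ suc)
∑-upTo-suc n f = cong (f 0 +_)
  (trans (cong (λ as → ∑ℚ as f) (sym (map-upTo suc n))) (∑-map suc (upTo n) f))

∑-upTo-last : ∀ n (f : ℕ → ℚ) → ∑ℚ (upTo (suc n)) f ≡ ∑ℚ (upTo n) f + f n
∑-upTo-last n f = trans (cong (λ as → ∑ℚ as f) (sym (upTo-∷ʳ n)))
  (trans (∑-++ (upTo n) _ f) (cong (∑ℚ (upTo n) f +_) (+-identityʳ (f n))))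

-- Binomial sums

binomialSum : ℕ → (ℕ → ℚ) → ℚ
binomialSum r x = ∑ℚ (upTo (suc r)) λ i → ι (r C i) * x i

binomialSum-cong : ∀ r {x y} → (∀ i → x i ≡ y i) → binomialSum r x ≡ binomialSum r y
binomialSum-cong r eq = ∑-cong (upTo (suc r)) λ i → cong (ι (r C i) *_) (eq i)

binomialSum-+ : ∀ r x y → binomialSum r (λ i → x i + y i) ≡ binomialSum r x + binomialSum r y
binomialSum-+ r x y = trans
  (∑-cong (upTo (suc r)) (λ i → *-distribˡ-+ (ι (r C i)) (x i) (y i)))
  (∑-+ (upTo (suc r)) (λ i → ι (r C i) * x i) (λ i → ι (r C i) * y i))

-- Pascal's rule: with E the shift of sequences, `binomialSum r x` is (1 + E)^r x at 0, and one
-- factor 1 + E is split off.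
binomialSum-suc : ∀ r x → binomialSum (suc r) x ≡ binomialSum r x + binomialSum r (x ∘ suc)
binomialSum-suc r x = begin
  binomialSum (suc r) x
    ≡⟨ ∑-upTo-suc (suc r) (λ i → ι (suc r C i) * x i) ⟩
  t₀ + ∑ℚ (upTo (suc r)) (λ i → ι (suc r C suc i) * x (suc i))
    ≡⟨ cong (t₀ +_) (∑-cong (upTo (suc r)) pascal) ⟩
  t₀ + ∑ℚ (upTo (suc r)) (λ i → ι (r C i) * x (suc i) + ι (r C suc i) * x (suc i))
    ≡⟨ cong (t₀ +_) (∑-+ (upTo (suc r)) (λ i → ι (r C i) * x (suc i)) (λ i → ι (r C suc i) * x (suc i))) ⟩
  t₀ + (binomialSum r (x ∘ suc) + T)
    ≡⟨ solve 3 (λ t s u → t :+ (s :+ u) := (t :+ u) :+ s) refl t₀ (binomialSum r (x ∘ suc)) T ⟩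
  (t₀ + T) + binomialSum r (x ∘ suc)
    -- The terms at index 0 agree by computation. The range now runs one index beyond
    -- `binomialSum r`; the extra coefficient `r C suc r` is 0.
    ≡⟨ cong (_+ binomialSum r (x ∘ suc)) (∑-upTo-suc (suc r) (λ i → ι (r C i) * x i)) ⟨
  ∑ℚ (upTo (suc (suc r))) (λ i → ι (r C i) * x i) + binomialSum r (x ∘ suc)
    ≡⟨ cong (_+ binomialSum r (x ∘ suc)) (∑-upTo-last (suc r) (λ i → ι (r C i) * x i)) ⟩
  (binomialSum r x + ι (r C suc r) * x (suc r)) + binomialSum r (x ∘ suc)
    ≡⟨ cong (λ k → (binomialSum r x + ι k * x (suc r)) + binomialSum r (x ∘ suc))
         (k>n⇒nCk≡0 (ℕ.n<1+n r)) ⟩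
  (binomialSum r x + 0ℚ * x (suc r)) + binomialSum r (x ∘ suc)
    ≡⟨ cong (_+ binomialSum r (x ∘ suc))
         (trans (cong (binomialSum r x +_) (*-zeroˡ (x (suc r)))) (+-identityʳ (binomialSum r x))) ⟩
  binomialSum r x + binomialSum r (x ∘ suc) ∎
  where
  t₀ T : ℚ
  t₀ = ι (suc r C 0) * x 0
  T  = ∑ℚ (upTo (suc r)) (λ i → ι (r C suc i) * x (suc i))
  pascal : ∀ i → ι (suc r C suc i) * x (suc i) ≡ ι (r C i) * x (suc i) + ι (r C suc i) * x (suc i)
  pascal i = trans
    (cong (_* x (suc i)) (trans (cong ι (sym (nCk+nC[k+1]≡[n+1]C[k+1] r i))) (ι-+ (r C i) (r C suc i))))
    (*-distribʳ-+ (x (suc i)) (ι (r C i)) (ι (r C suc i)))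

-- Pairing polynomials with functions of the exponents

-- Polynomials are paired with arbitrary functions g on exponent pairs; _ᵗ marks
-- the transpose of an operator under this pairing.

ev : (ℕ → ℕ → ℚ) → Poly → ℚ
ev g p = ∑ℚ p λ (c , a , b) → c * g a b

ev-cong : ∀ {g h} → (∀ a b → g a b ≡ h a b) → ∀ p → ev g p ≡ ev h p
ev-cong eq p = ∑-cong p λ (c , a , b) → cong (c *_) (eq a b)

ev-*ˡ : ∀ c g p → ev (λ a b → c * g a b) p ≡ c * ev g p
ev-*ˡ c g p = trans
  (∑-cong p λ (d , a , b) → solve 3 (λ d c x → d :* (c :* x) := c :* (d :* x)) refl d c (g a b))
  (∑-*ˡ p c _)

ev-∑ℚ : ∀ (as : List A) (g : A → ℕ → ℕ → ℚ) p →
  ev (λ a b → ∑ℚ as (λ s → g s a b)) p ≡ ∑ℚ as (λ s → ev (g s) p)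
ev-∑ℚ as g p = trans (∑-cong p λ (c , a , b) → sym (∑-*ˡ as c _)) (∑-swap p as _)

ev-∑ : ∀ g (as : List A) (f : A → Poly) → ev g (∑ as f) ≡ ∑ℚ as (λ a → ev g (f a))
ev-∑ g []       f = refl
ev-∑ g (a ∷ as) f = trans (∑-++ (f a) _ _) (cong (ev g (f a) +_) (ev-∑ g as f))

ev-*ᴾ : ∀ g p q → ev g (p *ᴾ q) ≡ ev (λ a b → ev (λ a′ b′ → g (a ℕ.+ a′) (b ℕ.+ b′)) q) p
ev-*ᴾ g p q = trans (∑-cartesianProductWith _*ᵗ_ p q _) (∑-cong p λ (c , a , b) →
  trans (∑-cong q λ (c′ , a′ , b′) → *-assoc c c′ _) (∑-*ˡ q c _))

ev-X^ : ∀ g k → ev g (X ^ᴾ k) ≡ g k 0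
ev-X^ g zero    = trans (+-identityʳ _) (*-identityˡ _)
ev-X^ g (suc k) = trans (ev-*ᴾ g X (X ^ᴾ k))
  (trans (+-identityʳ _) (trans (*-identityˡ _) (ev-X^ _ k)))

ev-Y^ : ∀ g k → ev g (Y ^ᴾ k) ≡ g 0 k
ev-Y^ g zero    = trans (+-identityʳ _) (*-identityˡ _)
ev-Y^ g (suc k) = trans (ev-*ᴾ g Y (Y ^ᴾ k))
  (trans (+-identityʳ _) (trans (*-identityˡ _) (ev-Y^ _ k)))

ev-X^*Y^ : ∀ g k l → ev g (X ^ᴾ k *ᴾ Y ^ᴾ l) ≡ g k l
ev-X^*Y^ g k l = trans (ev-*ᴾ g (X ^ᴾ k) (Y ^ᴾ l)) (trans (ev-X^ _ k)
  (trans (ev-Y^ _ l) (cong (λ x → g x l) (ℕ.+-identityʳ k))))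

δ : ℕ → ℕ → ℕ → ℕ → ℚ
δ i j a b = if does ((a ≟ i) ×-dec (b ≟ j)) then 1ℚ else 0ℚ

-- Reduces `_≈ᴾ_` to equality of pairings, where representations of a polynomial by different lists
-- of terms no longer matter.
coeff≡ev : ∀ p i j → coeff p i j ≡ ev (δ i j) p
coeff≡ev []                i j = refl
coeff≡ev ((c , a , b) ∷ p) i j = cong₂ _+_ (term (does ((a ≟ i) ×-dec (b ≟ j)))) (coeff≡ev p i j)
  where
  term : ∀ t → (if t then c else 0ℚ) ≡ c * (if t then 1ℚ else 0ℚ)
  term true  = sym (*-identityʳ c)
  term false = sym (*-zeroʳ c)

-- Transposes of D, of its divided powers and of 𝒢

Dᵗ : (ℕ → ℕ → ℚ) → ℕ → ℕ → ℚ
Dᵗ h a b = ι a * h (a ∸ 1) b + ι b * h a (b ∸ 1)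

ev-D : ∀ h p → ev h (D p) ≡ ev (Dᵗ h) p
ev-D h p = begin
  ev h (∂x p ++ ∂y p)
    ≡⟨ ∑-++ (∂x p) _ _ ⟩
  ev h (∂x p) + ev h (∂y p)
    ≡⟨ cong₂ _+_ (∑-map _ p _) (∑-map _ p _) ⟩
  ∑ℚ p (λ (c , a , b) → (c * ι a) * h (a ∸ 1) b) + ∑ℚ p (λ (c , a , b) → (c * ι b) * h a (b ∸ 1))
    ≡⟨ ∑-+ p _ _ ⟨
  ∑ℚ p (λ (c , a , b) → (c * ι a) * h (a ∸ 1) b + (c * ι b) * h a (b ∸ 1))
    ≡⟨ ∑-cong p (λ (c , a , b) → solve 5 (λ c x y z w →
         (c :* x) :* y :+ (c :* z) :* w := c :* (x :* y :+ z :* w)) refl c (ι a) _ (ι b) _) ⟩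
  ev (Dᵗ h) p ∎

-- The transpose of the divided power D⁽ʲ⁾ = Dʲ / j!; the clauses are the Leibniz
-- rules D⁽ʲ⁾(x p) = x D⁽ʲ⁾ p + D⁽ʲ⁻¹⁾ p and D⁽ʲ⁾(y p) = y D⁽ʲ⁾ p + D⁽ʲ⁻¹⁾ p.
D⁽⁾ᵗ : ℕ → (ℕ → ℕ → ℚ) → ℕ → ℕ → ℚ
D⁽⁾ᵗ zero    h a       b       = h a b
D⁽⁾ᵗ (suc j) h zero    zero    = 0ℚ
D⁽⁾ᵗ (suc j) h zero    (suc b) = D⁽⁾ᵗ (suc j) (λ x y → h x (suc y)) zero b + D⁽⁾ᵗ j h zero b
D⁽⁾ᵗ (suc j) h (suc a) b       = D⁽⁾ᵗ (suc j) (λ x y → h (suc x) y) a b + D⁽⁾ᵗ j h a b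

D⁽⁾ᵗ-cong : ∀ j {h k} → (∀ a b → h a b ≡ k a b) → ∀ a b → D⁽⁾ᵗ j h a b ≡ D⁽⁾ᵗ j k a b
D⁽⁾ᵗ-cong zero    eq a       b       = eq a b
D⁽⁾ᵗ-cong (suc j) eq zero    zero    = refl
D⁽⁾ᵗ-cong (suc j) eq zero    (suc b) =
  cong₂ _+_ (D⁽⁾ᵗ-cong (suc j) (λ x y → eq x (suc y)) zero b) (D⁽⁾ᵗ-cong j eq zero b)
D⁽⁾ᵗ-cong (suc j) eq (suc a) b       =
  cong₂ _+_ (D⁽⁾ᵗ-cong (suc j) (λ x y → eq (suc x) y) a b) (D⁽⁾ᵗ-cong j eq a b)

D⁽⁾ᵗ-+ : ∀ j h k a b → D⁽⁾ᵗ j (λ x y → h x y + k x y) a b ≡ D⁽⁾ᵗ j h a b + D⁽⁾ᵗ j k a b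
D⁽⁾ᵗ-+ zero    h k a       b       = refl
D⁽⁾ᵗ-+ (suc j) h k zero    zero    = refl
D⁽⁾ᵗ-+ (suc j) h k zero    (suc b) = trans
  (cong₂ _+_ (D⁽⁾ᵗ-+ (suc j) (λ x y → h x (suc y)) (λ x y → k x (suc y)) zero b) (D⁽⁾ᵗ-+ j h k zero b))
  (+-interchange (D⁽⁾ᵗ (suc j) (λ x y → h x (suc y)) zero b) _ (D⁽⁾ᵗ j h zero b) _)
D⁽⁾ᵗ-+ (suc j) h k (suc a) b       = trans
  (cong₂ _+_ (D⁽⁾ᵗ-+ (suc j) (λ x y → h (suc x) y) (λ x y → k (suc x) y) a b) (D⁽⁾ᵗ-+ j h k a b))
  (+-interchange (D⁽⁾ᵗ (suc j) (λ x y → h (suc x) y) a b) _ (D⁽⁾ᵗ j h a b) _)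

ι-suc : ∀ n → ι (suc n) ≡ 1ℚ + ι n
ι-suc = ι-+ 1

ι[1+n]*x≡x+ι[n]*x : ∀ n x → ι (suc n) * x ≡ x + ι n * x
ι[1+n]*x≡x+ι[n]*x n x = trans (cong (_* x) (ι-suc n))
  (trans (*-distribʳ-+ x 1ℚ (ι n)) (cong (_+ ι n * x) (*-identityˡ x)))

-- The Leibniz rule D(x p) = p + x D p, transposed.
Dᵗ-sucˡ : ∀ h a b → Dᵗ h (suc a) b ≡ h a b + Dᵗ (λ x y → h (suc x) y) a b
Dᵗ-sucˡ h a b = trans (cong (_+ ι b * h (suc a) (b ∸ 1))
    (trans (ι[1+n]*x≡x+ι[n]*x a (h a b)) (cong (h a b +_) (shift a))))
  (+-assoc (h a b) _ _)
  where
  shift : ∀ a → ι a * h a b ≡ ι a * h (suc (a ∸ 1)) b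
  -- Truncation makes the arguments of `h` differ here, 0 against 1, but the factor `ι 0` kills both
  -- terms.
  shift zero    = trans (*-zeroˡ (h 0 b)) (sym (*-zeroˡ (h 1 b)))
  shift (suc a) = refl

Dᵗ-sucʳ : ∀ h a b → Dᵗ h a (suc b) ≡ h a b + Dᵗ (λ x y → h x (suc y)) a b
Dᵗ-sucʳ h a b = trans (cong (ι a * h (a ∸ 1) (suc b) +_)
    (trans (ι[1+n]*x≡x+ι[n]*x b (h a b)) (cong (h a b +_) (shift b))))
  (solve 3 (λ x y z → x :+ (y :+ z) := y :+ (x :+ z)) refl
    (ι a * h (a ∸ 1) (suc b)) (h a b) (ι b * h a (suc (b ∸ 1))))
  where
  shift : ∀ b → ι b * h a b ≡ ι b * h a (suc (b ∸ 1))
  shift zero    = trans (*-zeroˡ (h a 0)) (sym (*-zeroˡ (h a 1)))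
  shift (suc b) = refl

-- Arranged for the induction in `D⁽⁾ᵗ-Dᵗ`: the bare y comes from the Leibniz rule for D, the two
-- multiples from the induction hypotheses.
ι[1+n]*[x+y] : ∀ n x y → ι (suc n) * (x + y) ≡ (y + ι (suc n) * x) + ι n * y
ι[1+n]*[x+y] n x y = begin
  ι (suc n) * (x + y)              ≡⟨ *-distribˡ-+ (ι (suc n)) x y ⟩
  ι (suc n) * x + ι (suc n) * y    ≡⟨ cong (ι (suc n) * x +_) (ι[1+n]*x≡x+ι[n]*x n y) ⟩
  ι (suc n) * x + (y + ι n * y)    ≡⟨ solve 3 (λ u y v → u :+ (y :+ v) := (y :+ u) :+ v) refl
                                        (ι (suc n) * x) y (ι n * y) ⟩
  (y + ι (suc n) * x) + ι n * y    ∎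

ι[1]*[x+y] : ∀ x y → ι 1 * (x + y) ≡ y + ι 1 * x
ι[1]*[x+y] x y = trans (ι[1+n]*[x+y] 0 x y)
  (trans (cong ((y + ι 1 * x) +_) (*-zeroˡ y)) (+-identityʳ (y + ι 1 * x)))

-- The transpose of D D⁽ʲ⁾ = (j+1) D⁽ʲ⁺¹⁾, by which the Leibniz clauses do define Dʲ / j!. The
-- induction strips one factor x or y from the monomial; `h` stays general because stripping shifts
-- it.
D⁽⁾ᵗ-Dᵗ : ∀ j h a b → D⁽⁾ᵗ j (Dᵗ h) a b ≡ ι (suc j) * D⁽⁾ᵗ (suc j) h a b
D⁽⁾ᵗ-Dᵗ zero    h zero    zero    =
  trans (cong₂ _+_ (*-zeroˡ (h 0 0)) (*-zeroˡ (h 0 0))) (sym (*-zeroʳ (ι 1)))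
D⁽⁾ᵗ-Dᵗ zero    h zero    (suc b) = trans (Dᵗ-sucʳ h 0 b)
  (trans (cong (h 0 b +_) (D⁽⁾ᵗ-Dᵗ 0 (λ x y → h x (suc y)) 0 b)) (sym (ι[1]*[x+y] (D⁽⁾ᵗ 1 (λ x y → h x (suc y)) 0 b) (h 0 b))))
D⁽⁾ᵗ-Dᵗ zero    h (suc a) b       = trans (Dᵗ-sucˡ h a b)
  (trans (cong (h a b +_) (D⁽⁾ᵗ-Dᵗ 0 (λ x y → h (suc x) y) a b)) (sym (ι[1]*[x+y] (D⁽⁾ᵗ 1 (λ x y → h (suc x) y) a b) (h a b))))
D⁽⁾ᵗ-Dᵗ (suc j) h zero    zero    = sym (*-zeroʳ (ι (suc (suc j))))
D⁽⁾ᵗ-Dᵗ (suc j) h zero    (suc b) = trans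
  (cong₂ _+_
    (trans (D⁽⁾ᵗ-cong (suc j) (Dᵗ-sucʳ h) 0 b) (trans (D⁽⁾ᵗ-+ (suc j) h _ 0 b)
      (cong (D⁽⁾ᵗ (suc j) h 0 b +_) (D⁽⁾ᵗ-Dᵗ (suc j) _ 0 b))))
    (D⁽⁾ᵗ-Dᵗ j h 0 b))
  (sym (ι[1+n]*[x+y] (suc j) _ (D⁽⁾ᵗ (suc j) h 0 b)))
D⁽⁾ᵗ-Dᵗ (suc j) h (suc a) b       = trans
  (cong₂ _+_
    (trans (D⁽⁾ᵗ-cong (suc j) (Dᵗ-sucˡ h) a b) (trans (D⁽⁾ᵗ-+ (suc j) h _ a b)
      (cong (D⁽⁾ᵗ (suc j) h a b +_) (D⁽⁾ᵗ-Dᵗ (suc j) _ a b))))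
    (D⁽⁾ᵗ-Dᵗ j h a b))
  (sym (ι[1+n]*[x+y] (suc j) _ (D⁽⁾ᵗ (suc j) h a b)))

ev-D^ : ∀ j h p → ev h (fold p D j) ≡ ι (j !) * ev (D⁽⁾ᵗ j h) p
ev-D^ zero    h p = sym (*-identityˡ _)
ev-D^ (suc j) h p = begin
  ev h (D (fold p D j))                               ≡⟨ ev-D h (fold p D j) ⟩
  ev (Dᵗ h) (fold p D j)                              ≡⟨ ev-D^ j (Dᵗ h) p ⟩
  ι (j !) * ev (D⁽⁾ᵗ j (Dᵗ h)) p                      ≡⟨ cong (ι (j !) *_) (ev-cong (D⁽⁾ᵗ-Dᵗ j h) p) ⟩
  ι (j !) * ev (λ a b → ι (suc j) * D⁽⁾ᵗ (suc j) h a b) p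
    ≡⟨ cong (ι (j !) *_) (ev-*ˡ (ι (suc j)) _ p) ⟩
  ι (j !) * (ι (suc j) * ev (D⁽⁾ᵗ (suc j) h) p)
    ≡⟨ solve 3 (λ x y z → x :* (y :* z) := (y :* x) :* z) refl (ι (j !)) (ι (suc j)) _ ⟩
  (ι (suc j) * ι (j !)) * ev (D⁽⁾ᵗ (suc j) h) p
    ≡⟨ cong (_* ev (D⁽⁾ᵗ (suc j) h) p) (ι-* (suc j) (j !)) ⟨
  ι (suc j !) * ev (D⁽⁾ᵗ (suc j) h) p                 ∎

-- Index shift: 𝒢ᵗ r is the transpose of 𝒢 (suc r).
𝒢ᵗ : ℕ → (ℕ → ℕ → ℚ) → ℕ → ℕ → ℚ
𝒢ᵗ r g a b = binomialSum r λ i →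
  D⁽⁾ᵗ (suc i) (λ x y → g (suc i ℕ.+ x) (suc r ℕ.+ y)) a b

-- The factors Yʳ and Xʲ only shift the arguments of `g`, and the j! produced by `ev-D^` cancels the
-- denominator of the coefficient.
ev-𝒢 : ∀ r g p → ev g (𝒢 (suc r) p) ≡ ev (𝒢ᵗ r g) p
ev-𝒢 r g p = begin
  ev g (𝒢 (suc r) p)
    ≡⟨ ev-*ᴾ g (Y ^ᴾ suc r) (∑ (upTo (suc r)) S) ⟩
  ev (λ a b → ev (λ a′ b′ → g (a ℕ.+ a′) (b ℕ.+ b′)) (∑ (upTo (suc r)) S)) (Y ^ᴾ suc r)
    ≡⟨ ev-Y^ _ (suc r) ⟩
  ev (λ x y → g x (suc r ℕ.+ y)) (∑ (upTo (suc r)) S)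
    ≡⟨ ev-∑ _ (upTo (suc r)) S ⟩
  ∑ℚ (upTo (suc r)) (λ i → ev (λ x y → g x (suc r ℕ.+ y)) (S i))
    ≡⟨ ∑-cong (upTo (suc r)) summand ⟩
  ∑ℚ (upTo (suc r)) (λ i → ev (λ a b → ι (r C i) * D⁽⁾ᵗ (suc i) (h i) a b) p)
    ≡⟨ ev-∑ℚ (upTo (suc r)) _ p ⟨
  ev (𝒢ᵗ r g) p ∎
  where
  h : ℕ → ℕ → ℕ → ℚ
  h i x y = g (suc i ℕ.+ x) (suc r ℕ.+ y)
  q : ℕ → ℚ
  q i = (ℤ.+ (r C i) ℚ./ (suc i !)) {{ suc i !≢0 }}
  S : ℕ → Poly
  S i = constᴾ (q i) *ᴾ X ^ᴾ suc i *ᴾ fold p D (suc i)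
  summand : ∀ i → ev (λ x y → g x (suc r ℕ.+ y)) (S i) ≡ ev (λ a b → ι (r C i) * D⁽⁾ᵗ (suc i) (h i) a b) p
  summand i = begin
    ev (λ x y → g x (suc r ℕ.+ y)) (S i)
      ≡⟨ ev-*ᴾ _ (constᴾ (q i) *ᴾ X ^ᴾ suc i) (fold p D (suc i)) ⟩
    ev (λ a b → ev (λ x y → g (a ℕ.+ x) (suc r ℕ.+ (b ℕ.+ y))) (fold p D (suc i))) (constᴾ (q i) *ᴾ X ^ᴾ suc i)
      ≡⟨ ev-*ᴾ _ (constᴾ (q i)) (X ^ᴾ suc i) ⟩
    q i * ev (λ a b → ev (λ x y → g (a ℕ.+ x) (suc r ℕ.+ (b ℕ.+ y))) (fold p D (suc i))) (X ^ᴾ suc i) + 0ℚ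
      ≡⟨ +-identityʳ _ ⟩
    q i * ev (λ a b → ev (λ x y → g (a ℕ.+ x) (suc r ℕ.+ (b ℕ.+ y))) (fold p D (suc i))) (X ^ᴾ suc i)
      ≡⟨ cong (q i *_) (ev-X^ _ (suc i)) ⟩
    q i * ev (h i) (fold p D (suc i))
      ≡⟨ cong (q i *_) (ev-D^ (suc i) (h i) p) ⟩
    q i * (ι (suc i !) * ev (D⁽⁾ᵗ (suc i) (h i)) p)
      ≡⟨ *-assoc (q i) _ _ ⟨
    (q i * ι (suc i !)) * ev (D⁽⁾ᵗ (suc i) (h i)) p
      ≡⟨ cong (_* ev (D⁽⁾ᵗ (suc i) (h i)) p) cancel ⟩
    ι (r C i) * ev (D⁽⁾ᵗ (suc i) (h i)) p
      ≡⟨ ev-*ˡ (ι (r C i)) _ p ⟨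
    ev (λ a b → ι (r C i) * D⁽⁾ᵗ (suc i) (h i) a b) p ∎
    where
    cancel : q i * ι (suc i !) ≡ ι (r C i)
    cancel = begin
      q i * ι (suc i !)          ≡⟨ cong (λ k → q i * ι k) (ℕ.*-identityˡ (suc i !)) ⟨
      q i * ι (1 ℕ.* suc i !)    ≡⟨ /-*-cancel (r C i) 1 (suc i !) {{ suc i !≢0 }} ⟩
      ι ((r C i) ℕ.* 1)            ≡⟨ cong ι (ℕ.*-identityʳ (r C i)) ⟩
      ι (r C i)                  ∎

-- Insertion of the top letter

-- Defined on words of every length, so that `λ w → F (a ∷ w)` is again a weight.
Weight : ℕ → Set
Weight n = ∀ {N} → Word n N → ℚ

-- Deleting the top letters of `w`, `r` in number, leaves `π`. The relation records which words
-- `insertionSum` reaches, so that facts on their letter counts can be used under the sum.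
data Insertion {n} : ∀ {N L} → Word n N → ℕ → Word (suc n) L → Set where
  []     : Insertion [] 0 []
  top    : ∀ {N L r} {π : Word n N} {w : Word (suc n) L} →
           Insertion π r w → Insertion π (suc r) (fromℕ n ∷ w)
  letter : ∀ {N L r} {π : Word n N} {w : Word (suc n) L} a →
           Insertion π r w → Insertion (a ∷ π) r (inject₁ a ∷ w)

-- The recursion decides whether the resulting word begins with a top letter or with the head of
-- `π`; each insertion is thus counted once.
insertionSum : ∀ {n N} → Word n N → ℕ → Weight (suc n) → ℚ
insertionSum     []      zero    F = F []
insertionSum {n} []      (suc r) F = insertionSum [] r (λ w → F (fromℕ n ∷ w))
insertionSum     (a ∷ π) zero    F = insertionSum π zero (λ w → F (inject₁ a ∷ w))
insertionSum {n} (a ∷ π) (suc r) F =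
  insertionSum (a ∷ π) r (λ w → F (fromℕ n ∷ w)) + insertionSum π (suc r) (λ w → F (inject₁ a ∷ w))

insertionSum-cong : ∀ {n N} (π : Word n N) r {F G : Weight (suc n)} →
  (∀ {L} {w : Word (suc n) L} → Insertion π r w → F w ≡ G w) →
  insertionSum π r F ≡ insertionSum π r G
insertionSum-cong []      zero    eq = eq []
insertionSum-cong []      (suc r) eq = insertionSum-cong [] r (λ ins → eq (top ins))
insertionSum-cong (a ∷ π) zero    eq = insertionSum-cong π zero (λ ins → eq (letter a ins))
insertionSum-cong (a ∷ π) (suc r) eq = cong₂ _+_
  (insertionSum-cong (a ∷ π) r (λ ins → eq (top ins)))
  (insertionSum-cong π (suc r) (λ ins → eq (letter a ins)))

insertionSum-zero : ∀ {n N} (π : Word n N) r → insertionSum π r (λ _ → 0ℚ) ≡ 0ℚ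
insertionSum-zero []      zero    = refl
insertionSum-zero []      (suc r) = insertionSum-zero [] r
insertionSum-zero (a ∷ π) zero    = insertionSum-zero π zero
insertionSum-zero (a ∷ π) (suc r) = cong₂ _+_ (insertionSum-zero (a ∷ π) r) (insertionSum-zero π (suc r))

count-∷-≡ : ∀ {n N} {i a : Fin n} (w : Word n N) → i ≡ a → count (i ≟ᶠ_) (a ∷ w) ≡ suc (count (i ≟ᶠ_) w)
count-∷-≡ {i = i} {a} w i≡a with i ≟ᶠ a
... | yes _  = refl
... | no i≢a = contradiction i≡a i≢a

count-∷-≢ : ∀ {n N} {i a : Fin n} (w : Word n N) → i ≢ a → count (i ≟ᶠ_) (a ∷ w) ≡ count (i ≟ᶠ_) w
count-∷-≢ {i = i} {a} w i≢a with i ≟ᶠ a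
... | yes i≡a = contradiction i≡a i≢a
... | no _    = refl

count-top : ∀ {n N L r} {π : Word n N} {w : Word (suc n) L} →
  Insertion π r w → count (fromℕ n ≟ᶠ_) w ≡ r
count-top []                     = refl
count-top (top {w = w} ins)      = trans (count-∷-≡ {i = fromℕ _} w refl) (cong suc (count-top ins))
count-top (letter {w = w} a ins) = trans (count-∷-≢ w fromℕ≢inject₁) (count-top ins)

count-inject₁ : ∀ {n N L r} {π : Word n N} {w : Word (suc n) L} → Insertion π r w →
  ∀ i → count (inject₁ i ≟ᶠ_) w ≡ count (i ≟ᶠ_) π
count-inject₁ []                             i = refl
count-inject₁ (top {w = w} ins)              i =
  trans (count-∷-≢ w (fromℕ≢inject₁ ∘ sym)) (count-inject₁ ins i)
count-inject₁ (letter {π = π} {w = w} a ins) i with i ≟ᶠ a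
... | yes i≡a = trans (count-∷-≡ w (cong inject₁ i≡a)) (cong suc (count-inject₁ ins i))
... | no i≢a  = trans (count-∷-≢ w (i≢a ∘ inject₁-injective)) (count-inject₁ ins i)

∑-allWords-suc : ∀ n N (F : Weight n) →
  ∑ℚ (allWords n (suc N)) F ≡ ∑ℚ (allFin n) (λ a → ∑ℚ (allWords n N) (λ w → F (a ∷ w)))
∑-allWords-suc n N F = ∑-cartesianProductWith _∷_ (allFin n) (allWords n N) F

∑-allWords-last : ∀ n N (F : Weight (suc n)) → ∑ℚ (allWords (suc n) (suc N)) F ≡
  ∑ℚ (allFin n) (λ a → ∑ℚ (allWords (suc n) N) (λ w → F (inject₁ a ∷ w))) +
  ∑ℚ (allWords (suc n) N) (λ w → F (fromℕ n ∷ w))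
∑-allWords-last n N F = trans (∑-allWords-suc (suc n) N F) 
  (∑-allFin-last n (λ a → ∑ℚ (allWords (suc n) N) (λ w → F (a ∷ w))))

-- For such weights a sum over all words sees only those with exactly `r` top letters.
TopSupported : ∀ {n} → ℕ → Weight (suc n) → Set
TopSupported {n} r F = ∀ {L} (w : Word (suc n) L) → count (fromℕ n ≟ᶠ_) w ≢ r → F w ≡ 0ℚ

TopSupported-top : ∀ {n r} {F : Weight (suc n)} → TopSupported (suc r) F →
  TopSupported r (λ w → F (fromℕ n ∷ w))
TopSupported-top sup w ≢r = sup _ (λ eq → ≢r (ℕ.suc-injective (trans (sym (count-∷-≡ w refl)) eq)))

TopSupported-letter : ∀ {n r} {F : Weight (suc n)} a → TopSupported r F →
  TopSupported r (λ w → F (inject₁ a ∷ w))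
TopSupported-letter a sup w ≢r = sup _ (λ eq → ≢r (trans (sym (count-∷-≢ w fromℕ≢inject₁)) eq))

-- A word with `r` top letters arises by insertion from exactly one `π`, the word left after
-- deleting them. The induction follows the first letter.
∑-allWords-insertion : ∀ n N r (F : Weight (suc n)) → TopSupported r F →
  ∑ℚ (allWords (suc n) (N ℕ.+ r)) F ≡ ∑ℚ (allWords n N) (λ π → insertionSum π r F)
∑-allWords-insertion n zero    zero    F sup = refl
∑-allWords-insertion n zero    (suc r) F sup = begin
  ∑ℚ (allWords (suc n) (suc r)) F
    ≡⟨ ∑-allWords-last n r F ⟩
  ∑ℚ (allFin n) (λ a → ∑ℚ (allWords (suc n) r) (λ w → F (inject₁ a ∷ w))) +
  ∑ℚ (allWords (suc n) r) (λ w → F (fromℕ n ∷ w))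
    ≡⟨ cong₂ _+_
         -- After a first letter below the top only `r` places remain, too few for `suc r` top
         -- letters.
         (∑-zero (allFin n) (λ a → ∑-zero (allWords (suc n) r) (λ w →
           TopSupported-letter {F = F} a sup w (ℕ.<⇒≢ (s≤s (count≤n (fromℕ n ≟ᶠ_) w))))))
         (∑-allWords-insertion n 0 r (λ w → F (fromℕ n ∷ w)) (TopSupported-top {F = F} sup)) ⟩
  0ℚ + (insertionSum [] (suc r) F + 0ℚ)
    ≡⟨ +-identityˡ _ ⟩
  insertionSum [] (suc r) F + 0ℚ ∎
∑-allWords-insertion n (suc N) zero    F sup = begin
  ∑ℚ (allWords (suc n) (suc (N ℕ.+ 0))) F
    ≡⟨ ∑-allWords-last n (N ℕ.+ 0) F ⟩
  ∑ℚ (allFin n) (λ a → ∑ℚ (allWords (suc n) (N ℕ.+ 0)) (λ w → F (inject₁ a ∷ w))) +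
  ∑ℚ (allWords (suc n) (N ℕ.+ 0)) (λ w → F (fromℕ n ∷ w))
    ≡⟨ cong₂ _+_
         (∑-cong (allFin n) (λ a → ∑-allWords-insertion n N 0 (λ w → F (inject₁ a ∷ w))
           (TopSupported-letter {F = F} a sup)))
         -- A leading top letter already exceeds the prescribed count 0.
         (∑-zero (allWords (suc n) (N ℕ.+ 0)) (λ w →
           sup (fromℕ n ∷ w) (λ eq → ℕ.1+n≢0 (trans (sym (count-∷-≡ {i = fromℕ n} w refl)) eq)))) ⟩
  ∑ℚ (allFin n) (λ a → ∑ℚ (allWords n N) (λ π → insertionSum (a ∷ π) 0 F)) + 0ℚ
    ≡⟨ +-identityʳ _ ⟩
  ∑ℚ (allFin n) (λ a → ∑ℚ (allWords n N) (λ π → insertionSum (a ∷ π) 0 F))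
    ≡⟨ ∑-allWords-suc n N (λ π → insertionSum π 0 F) ⟨
  ∑ℚ (allWords n (suc N)) (λ π → insertionSum π 0 F) ∎
∑-allWords-insertion n (suc N) (suc r) F sup = begin
  ∑ℚ (allWords (suc n) (suc (N ℕ.+ suc r))) F
    ≡⟨ ∑-allWords-last n (N ℕ.+ suc r) F ⟩
  ∑ℚ (allFin n) (λ a → ∑ℚ (allWords (suc n) (N ℕ.+ suc r)) (λ w → F (inject₁ a ∷ w))) +
  ∑ℚ (allWords (suc n) (N ℕ.+ suc r)) Fᵗ
    ≡⟨ cong₂ _+_
         (∑-cong (allFin n) (λ a → ∑-allWords-insertion n N (suc r) (λ w → F (inject₁ a ∷ w))
           (TopSupported-letter {F = F} a sup)))
         -- After a leading top letter all `suc N` old letters are still to come, so the length is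
         -- read as `suc N + r`.
         (trans (cong (λ L → ∑ℚ (allWords (suc n) L) Fᵗ) (ℕ.+-suc N r))
           (trans (∑-allWords-insertion n (suc N) r Fᵗ (TopSupported-top {F = F} sup))
             (∑-allWords-suc n N (λ π → insertionSum π r Fᵗ)))) ⟩
  ∑ℚ (allFin n) (λ a → ∑ℚ (allWords n N) (λ π → insertionSum π (suc r) (λ w → F (inject₁ a ∷ w)))) +
  ∑ℚ (allFin n) (λ a → ∑ℚ (allWords n N) (λ π → insertionSum (a ∷ π) r Fᵗ))
    ≡⟨ +-comm (∑ℚ (allFin n) _) _ ⟩
  ∑ℚ (allFin n) (λ a → ∑ℚ (allWords n N) (λ π → insertionSum (a ∷ π) r Fᵗ)) +
  ∑ℚ (allFin n) (λ a → ∑ℚ (allWords n N) (λ π → insertionSum π (suc r) (λ w → F (inject₁ a ∷ w))))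
    ≡⟨ ∑-+ (allFin n) _ _ ⟨
  ∑ℚ (allFin n) (λ a →
    ∑ℚ (allWords n N) (λ π → insertionSum (a ∷ π) r Fᵗ) +
    ∑ℚ (allWords n N) (λ π → insertionSum π (suc r) (λ w → F (inject₁ a ∷ w))))
    ≡⟨ ∑-cong (allFin n) (λ a → ∑-+ (allWords n N) _ _) ⟨
  ∑ℚ (allFin n) (λ a → ∑ℚ (allWords n N) (λ π → insertionSum (a ∷ π) (suc r) F))
    ≡⟨ ∑-allWords-suc n N (λ π → insertionSum π (suc r) F) ⟨
  ∑ℚ (allWords n (suc N)) (λ π → insertionSum π (suc r) F) ∎
  where
  Fᵗ : Weight (suc n)
  Fᵗ w = F (fromℕ n ∷ w)

-- Distributing top letters over the gaps of a word

-- The sum of φ l over all choices of j distinct gaps, of which l are costly,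
-- among f free and c costly ones.
gapSum : ℕ → ℕ → (ℕ → ℚ) → ℕ → ℚ
gapSum f       c       φ zero    = φ 0
gapSum zero    zero    φ (suc j) = 0ℚ
gapSum zero    (suc c) φ (suc j) = gapSum zero c φ (suc j) + gapSum zero c (φ ∘ suc) j
gapSum (suc f) c       φ (suc j) = gapSum f c φ (suc j) + gapSum f c φ j

gapSum-cong : ∀ f c {φ ψ} → (∀ l → φ l ≡ ψ l) → ∀ j → gapSum f c φ j ≡ gapSum f c ψ j
gapSum-cong f       c       eq zero    = eq 0
gapSum-cong zero    zero    eq (suc j) = refl
gapSum-cong zero    (suc c) eq (suc j) =
  cong₂ _+_ (gapSum-cong zero c eq (suc j)) (gapSum-cong zero c (eq ∘ suc) j)
gapSum-cong (suc f) c       eq (suc j) =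
  cong₂ _+_ (gapSum-cong f c eq (suc j)) (gapSum-cong f c eq j)

-- The definition treats costly gaps only after all free ones; this makes the order immaterial.
gapSum-costly : ∀ f c φ j →
  gapSum f (suc c) φ (suc j) ≡ gapSum f c φ (suc j) + gapSum f c (φ ∘ suc) j
gapSum-costly zero    c φ j       = refl
gapSum-costly (suc f) c φ zero    = trans (cong (_+ φ 0) (gapSum-costly f c φ 0))
  (solve 3 (λ x y z → (x :+ y) :+ z := (x :+ z) :+ y) refl (gapSum f c φ 1) (φ 1) (φ 0))
gapSum-costly (suc f) c φ (suc j) = trans
  (cong₂ _+_ (gapSum-costly f c φ (suc j)) (gapSum-costly f c φ j))
  (+-interchange (gapSum f c φ (suc (suc j))) _ (gapSum f c φ (suc j)) _)

-- Choosing gaps is the action of a divided power of D on a monomial: l of the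
-- j derivatives hit the b factors y, and k the a factors x.
D⁽⁾ᵗ≡gapSum : ∀ j h φ a b →
  (∀ a′ b′ k l → a′ ℕ.+ k ≡ a → b′ ℕ.+ l ≡ b → k ℕ.+ l ≡ j → h a′ b′ ≡ φ l) →
  D⁽⁾ᵗ j h a b ≡ gapSum a b φ j
D⁽⁾ᵗ≡gapSum zero    h φ a       b       eq = eq a b 0 0 (ℕ.+-identityʳ a) (ℕ.+-identityʳ b) refl
D⁽⁾ᵗ≡gapSum (suc j) h φ zero    zero    eq = refl
D⁽⁾ᵗ≡gapSum (suc j) h φ zero    (suc b) eq = cong₂ _+_
  (D⁽⁾ᵗ≡gapSum (suc j) _ φ zero b (λ a′ b′ k l p q s → eq a′ (suc b′) k l p (cong suc q) s))
  (D⁽⁾ᵗ≡gapSum j h (φ ∘ suc) zero b (λ a′ b′ k l p q s →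
    eq a′ b′ k (suc l) p (trans (ℕ.+-suc b′ l) (cong suc q)) (trans (ℕ.+-suc k l) (cong suc s))))
D⁽⁾ᵗ≡gapSum (suc j) h φ (suc a) b       eq = cong₂ _+_
  (D⁽⁾ᵗ≡gapSum (suc j) _ φ a b (λ a′ b′ k l p q s → eq (suc a′) b′ k l (cong suc p) q s))
  (D⁽⁾ᵗ≡gapSum j h φ a b (λ a′ b′ k l p q s →
    eq a′ b′ (suc k) l (trans (ℕ.+-suc a′ k) (cong suc p)) q (cong suc s)))

-- The sum of φ l over all ways of putting r letters into f free and c costly
-- gaps, l being the number of occupied costly gaps: there are (r-1) C (j-1)
-- ways to occupy a given set of j gaps.
distribute : ℕ → ℕ → ℕ → (ℕ → ℚ) → ℚ
distribute zero    f c φ = φ 0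
distribute (suc r) f c φ = binomialSum r (λ i → gapSum f c φ (suc i))

distribute-cong : ∀ r f c {φ ψ} → (∀ l → φ l ≡ ψ l) → distribute r f c φ ≡ distribute r f c ψ
distribute-cong zero    f c eq = eq 0
distribute-cong (suc r) f c eq = binomialSum-cong r (λ i → gapSum-cong f c eq (suc i))

binomialSum-0 : ∀ x → binomialSum 0 x ≡ x 0
binomialSum-0 x = trans (+-identityʳ (1ℚ * x 0)) (*-identityˡ (x 0))

-- One free gap is set aside and may stay empty: then r letters fill it together with exactly i
-- given other gaps in `r C i` ways.
distribute-suc : ∀ r f c φ → distribute r (suc f) c φ ≡ binomialSum r (gapSum f c φ)
distribute-suc zero    f c φ = sym (binomialSum-0 (gapSum f c φ))
distribute-suc (suc r) f c φ = begin
  binomialSum r (λ i → gapSum f c φ (suc i) + gapSum f c φ i)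
    ≡⟨ binomialSum-+ r (gapSum f c φ ∘ suc) (gapSum f c φ) ⟩
  binomialSum r (gapSum f c φ ∘ suc) + binomialSum r (gapSum f c φ)
    ≡⟨ +-comm (binomialSum r (gapSum f c φ ∘ suc)) _ ⟩
  binomialSum r (gapSum f c φ) + binomialSum r (gapSum f c φ ∘ suc)
    ≡⟨ binomialSum-suc r (gapSum f c φ) ⟨
  binomialSum (suc r) (gapSum f c φ) ∎

distribute-one : ∀ r φ → distribute r 1 0 φ ≡ φ 0
distribute-one r φ = trans (distribute-suc r 0 0 φ) (first r)
  where
  first : ∀ r → binomialSum r (gapSum 0 0 φ) ≡ φ 0
  first zero    = binomialSum-0 (gapSum 0 0 φ)
  first (suc r) = trans (binomialSum-suc r (gapSum 0 0 φ)) (trans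
    (cong₂ _+_ (first r) (∑-zero (upTo (suc r)) (λ i → *-zeroʳ (ι (r C i)))))
    (+-identityʳ (φ 0)))

-- Either a letter enters the first free gap, which stays open at no cost for the remaining `r`, or
-- that gap stays empty and is dropped.
distribute-free : ∀ r f c φ →
  distribute (suc r) (suc f) c φ ≡ distribute r (suc f) c φ + distribute (suc r) f c φ
distribute-free r f c φ = begin
  binomialSum r (λ i → gapSum f c φ (suc i) + gapSum f c φ i)
    ≡⟨ binomialSum-+ r (gapSum f c φ ∘ suc) (gapSum f c φ) ⟩
  distribute (suc r) f c φ + binomialSum r (gapSum f c φ)
    ≡⟨ +-comm (distribute (suc r) f c φ) _ ⟩
  binomialSum r (gapSum f c φ) + distribute (suc r) f c φ
    ≡⟨ cong (_+ distribute (suc r) f c φ) (distribute-suc r f c φ) ⟨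
  distribute r (suc f) c φ + distribute (suc r) f c φ ∎

-- Once occupied, a costly gap takes further top letters for free.
distribute-costly : ∀ r f c φ →
  distribute (suc r) f (suc c) φ ≡ distribute r (suc f) c (φ ∘ suc) + distribute (suc r) f c φ
distribute-costly r f c φ = begin
  binomialSum r (λ i → gapSum f (suc c) φ (suc i))
    ≡⟨ binomialSum-cong r (gapSum-costly f c φ) ⟩
  binomialSum r (λ i → gapSum f c φ (suc i) + gapSum f c (φ ∘ suc) i)
    ≡⟨ binomialSum-+ r (gapSum f c φ ∘ suc) (gapSum f c (φ ∘ suc)) ⟩
  distribute (suc r) f c φ + binomialSum r (gapSum f c (φ ∘ suc))
    ≡⟨ +-comm (distribute (suc r) f c φ) _ ⟩
  binomialSum r (gapSum f c (φ ∘ suc)) + distribute (suc r) f c φ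
    ≡⟨ cong (_+ distribute (suc r) f c φ) (distribute-suc r f c (φ ∘ suc)) ⟨
  distribute r (suc f) c (φ ∘ suc) + distribute (suc r) f c φ ∎

-- Descents

descentSet : ∀ {n N} → Word n (suc N) → Subset N
descentSet w = tabulate λ i → does (lookup w (fsuc i) <ᶠ? lookup w (inject₁ i))

des-∷-< : ∀ {n N} (b a : Fin n) (w : Word n N) → a Fin.< b → des (b ∷ a ∷ w) ≡ suc (des (a ∷ w))
des-∷-< b a w a<b = cong (λ t → ∣ t ∷ descentSet (a ∷ w) ∣)
  (dec-true (a <ᶠ? b) a<b)

des-∷-≮ : ∀ {n N} (b a : Fin n) (w : Word n N) → ¬ a Fin.< b → des (b ∷ a ∷ w) ≡ des (a ∷ w)
des-∷-≮ b a w a≮b = cong (λ t → ∣ t ∷ descentSet (a ∷ w) ∣)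
  (dec-false (a <ᶠ? b) a≮b)

des-∷-≤ : ∀ {n N} (a : Fin n) (w : Word n N) → des (a ∷ w) ≤ N
des-∷-≤ a w = ∣p∣≤n (descentSet (a ∷ w))

des-map-inject₁ : ∀ {n N} (π : Word n N) → des (Vec.map inject₁ π) ≡ des π
des-map-inject₁ []          = refl
des-map-inject₁ (a ∷ [])    = refl
des-map-inject₁ (b ∷ a ∷ π) with a <ᶠ? b | des-map-inject₁ (a ∷ π)
... | yes a<b | ih = trans
  (des-∷-< (inject₁ b) (inject₁ a) (Vec.map inject₁ π) (subst₂ ℕ._<_ (sym (toℕ-inject₁ a)) (sym (toℕ-inject₁ b)) a<b))
  (trans (cong suc ih) (sym (des-∷-< b a π a<b)))
... | no a≮b | ih  = trans
  (des-∷-≮ (inject₁ b) (inject₁ a) (Vec.map inject₁ π) (a≮b ∘ subst₂ ℕ._<_ (toℕ-inject₁ a) (toℕ-inject₁ b)))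
  (trans ih (sym (des-∷-≮ b a π a≮b)))

des-∷-top : ∀ {n N} (p : Fin (suc n)) (w : Word (suc n) N) → des (p ∷ fromℕ n ∷ w) ≡ des (fromℕ n ∷ w)
des-∷-top p w = des-∷-≮ p _ w (ℕ.≤⇒≯ (≤fromℕ p))

des-top-∷ : ∀ {n N} (a : Fin n) (w : Word (suc n) N) →
  des (fromℕ n ∷ inject₁ a ∷ w) ≡ suc (des (inject₁ a ∷ w))
des-top-∷ {n} a w = des-∷-< (fromℕ n) (inject₁ a) w
  (subst (toℕ (inject₁ a) ℕ.<_) (sym (toℕ-fromℕ n)) (inject₁ℕ< a))

-- The gaps counted are those to the right of p, so the free ones are the
-- descents of p ∷ π together with its end.
insertionSum-des-∷ : ∀ {n N} (p : Fin (suc n)) (π : Word n N) r (φ : ℕ → ℚ) →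
  let d = des (p ∷ Vec.map inject₁ π) in
  insertionSum π r (λ w → φ (des (p ∷ w))) ≡ distribute r (suc d) (N ∸ d) (λ l → φ (d ℕ.+ l))
insertionSum-des-∷     p []      zero    φ = refl
insertionSum-des-∷ {n} p []      (suc r) φ = begin
  insertionSum [] r (λ w → φ (des (p ∷ fromℕ n ∷ w)))
    ≡⟨ insertionSum-cong [] r (λ {_} {w} _ → cong φ (des-∷-top p w)) ⟩
  insertionSum [] r (λ w → φ (des (fromℕ n ∷ w)))
    ≡⟨ insertionSum-des-∷ (fromℕ n) [] r φ ⟩
  distribute r 1 0 φ
    ≡⟨ distribute-one r φ ⟩
  φ 0
    ≡⟨ distribute-one (suc r) φ ⟨
  distribute (suc r) 1 0 φ ∎
insertionSum-des-∷ p (a ∷ π) zero φ with inject₁ a <ᶠ? p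
... | yes a<p = trans
  (insertionSum-cong π 0 (λ {_} {w} _ → cong φ (des-∷-< p (inject₁ a) w a<p)))
  (trans (insertionSum-des-∷ (inject₁ a) π 0 (φ ∘ suc))
    (cong (λ d → φ (d ℕ.+ 0)) (sym (des-∷-< p (inject₁ a) (Vec.map inject₁ π) a<p))))
... | no a≮p = trans
  (insertionSum-cong π 0 (λ {_} {w} _ → cong φ (des-∷-≮ p (inject₁ a) w a≮p)))
  (trans (insertionSum-des-∷ (inject₁ a) π 0 φ)
    (cong (λ d → φ (d ℕ.+ 0)) (sym (des-∷-≮ p (inject₁ a) (Vec.map inject₁ π) a≮p))))
insertionSum-des-∷ {n} {suc N} p (a ∷ π) (suc r) φ = begin
  insertionSum (a ∷ π) r (λ w → φ (des (p ∷ fromℕ n ∷ w))) +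
  insertionSum π (suc r) (λ w → φ (des (p ∷ inject₁ a ∷ w)))
    ≡⟨ cong (_+ insertionSum π (suc r) (λ w → φ (des (p ∷ inject₁ a ∷ w)))) (trans
         -- A top letter after `p` makes no descent with it and takes over as left neighbour. Its
         -- descent to `a` gives `suc d` descents in all, so the gap before `a` is now free.
         (insertionSum-cong (a ∷ π) r (λ {_} {w} _ → cong φ (des-∷-top p w)))
         (trans (insertionSum-des-∷ (fromℕ n) (a ∷ π) r φ) (cong G (des-top-∷ a π⁺)))) ⟩
  distribute r (suc (suc d)) (N ∸ d) (λ l → φ (suc d ℕ.+ l)) +
  insertionSum π (suc r) (λ w → φ (des (p ∷ inject₁ a ∷ w)))
    ≡⟨ rest (inject₁ a <ᶠ? p) ⟩
  G′ (des (p ∷ inject₁ a ∷ π⁺)) ∎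
  where
  π⁺ : Word (suc n) N
  π⁺ = Vec.map inject₁ π
  d : ℕ
  d = des (inject₁ a ∷ π⁺)
  G G′ : ℕ → ℚ
  G  d = distribute r (suc d) (suc N ∸ d) (λ l → φ (d ℕ.+ l))
  G′ d = distribute (suc r) (suc d) (suc N ∸ d) (λ l → φ (d ℕ.+ l))
  occupied : ℚ
  occupied = distribute r (suc (suc d)) (N ∸ d) (λ l → φ (suc d ℕ.+ l))
  rest : Dec (inject₁ a Fin.< p) →
    occupied + insertionSum π (suc r) (λ w → φ (des (p ∷ inject₁ a ∷ w))) ≡ G′ (des (p ∷ inject₁ a ∷ π⁺))
  -- The gap between `p` and `a` is a descent, hence free: occupied or not, it counts once.
  rest (yes a<p) = begin
    occupied + insertionSum π (suc r) (λ w → φ (des (p ∷ inject₁ a ∷ w)))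
      ≡⟨ cong (occupied +_) (trans
           (insertionSum-cong π (suc r) (λ {_} {w} _ → cong φ (des-∷-< p (inject₁ a) w a<p)))
           (insertionSum-des-∷ (inject₁ a) π (suc r) (φ ∘ suc))) ⟩
    occupied + distribute (suc r) (suc d) (N ∸ d) (λ l → φ (suc d ℕ.+ l))
      ≡⟨ distribute-free r (suc d) (N ∸ d) (λ l → φ (suc d ℕ.+ l)) ⟨
    G′ (suc d)
      ≡⟨ cong G′ (des-∷-< p (inject₁ a) π⁺ a<p) ⟨
    G′ (des (p ∷ inject₁ a ∷ π⁺)) ∎
  rest (no a≮p) = begin
    occupied + insertionSum π (suc r) (λ w → φ (des (p ∷ inject₁ a ∷ w)))
      ≡⟨ cong₂ _+_
           -- The gap is costly here: the descent made by occupying it moves from the base value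
           -- `suc d` into the count `suc l`.
           (distribute-cong r (suc (suc d)) (N ∸ d) (λ l → cong φ (sym (ℕ.+-suc d l))))
           (trans
             (insertionSum-cong π (suc r) (λ {_} {w} _ → cong φ (des-∷-≮ p (inject₁ a) w a≮p)))
             (insertionSum-des-∷ (inject₁ a) π (suc r) φ)) ⟩
    distribute r (suc (suc d)) (N ∸ d) (λ l → φ (d ℕ.+ suc l)) +
    distribute (suc r) (suc d) (N ∸ d) (λ l → φ (d ℕ.+ l))
      ≡⟨ distribute-costly r (suc d) (N ∸ d) (λ l → φ (d ℕ.+ l)) ⟨
    distribute (suc r) (suc d) (suc (N ∸ d)) (λ l → φ (d ℕ.+ l))
      -- Since `d ≤ N`, the truncated difference `suc N ∸ d` is `suc (N ∸ d)`.
      ≡⟨ cong (λ c → distribute (suc r) (suc d) c (λ l → φ (d ℕ.+ l)))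
           (ℕ.+-∸-assoc 1 (des-∷-≤ (inject₁ a) π⁺)) ⟨
    G′ d
      ≡⟨ cong G′ (des-∷-≮ p (inject₁ a) π⁺ a≮p) ⟨
    G′ (des (p ∷ inject₁ a ∷ π⁺)) ∎

-- The least letter can therefore serve as the left neighbour `p` of a whole word.
des-zero-∷ : ∀ {n N} (w : Word (suc n) N) → des (fzero ∷ w) ≡ des w
des-zero-∷ []      = refl
des-zero-∷ (a ∷ w) = des-∷-≮ fzero a w λ ()

des-≤ : ∀ {n N} (w : Word n N) → des w ≤ N
des-≤ []      = z≤n
des-≤ (a ∷ w) = ℕ.m≤n⇒m≤1+n (des-∷-≤ a w)

insertionSum-des : ∀ {n N} (π : Word n N) r (φ : ℕ → ℚ) →
  insertionSum π r (λ w → φ (des w)) ≡ distribute r (suc (des π)) (N ∸ des π) (λ l → φ (des π ℕ.+ l))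
insertionSum-des {N = N} π r φ = begin
  insertionSum π r (λ w → φ (des w))
    ≡⟨ insertionSum-cong π r (λ {_} {w} _ → cong φ (sym (des-zero-∷ w))) ⟩
  insertionSum π r (λ w → φ (des (fzero ∷ w)))
    ≡⟨ insertionSum-des-∷ fzero π r φ ⟩
  G (des (fzero ∷ Vec.map inject₁ π))
    ≡⟨ cong G (trans (des-zero-∷ (Vec.map inject₁ π)) (des-map-inject₁ π)) ⟩
  G (des π) ∎
  where
  G : ℕ → ℚ
  G d = distribute r (suc d) (N ∸ d) (λ l → φ (d ℕ.+ l))

-- If k free and l costly gaps are occupied, differentiation leaves x^(d+1-k) y^(N-d-l). Multiplying
-- by x^(k+l) y^(r+1) gives the monomial of a word of length N+r+1 with d+l descents.
insertionSum≡𝒢ᵗ : ∀ {n N} (π : Word n N) r g →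
  insertionSum π (suc r) (λ w → g (suc (des w)) ((N ℕ.+ suc r) ∸ des w)) ≡
  𝒢ᵗ r g (suc (des π)) (N ∸ des π)
insertionSum≡𝒢ᵗ {N = N} π r g = trans
  (insertionSum-des π (suc r) (λ d → g (suc d) ((N ℕ.+ suc r) ∸ d)))
  (sym (binomialSum-cong r (λ i → D⁽⁾ᵗ≡gapSum (suc i) _ _ (suc d) (N ∸ d) (exponents i))))
  where
  d : ℕ
  d = des π
  exponents : ∀ i x y k l → x ℕ.+ k ≡ suc d → y ℕ.+ l ≡ N ∸ d → k ℕ.+ l ≡ suc i →
    g (suc i ℕ.+ x) (suc r ℕ.+ y) ≡ g (suc (d ℕ.+ l)) ((N ℕ.+ suc r) ∸ (d ℕ.+ l))
  exponents i x y k l x+k≡ y+l≡ k+l≡ = cong₂ g x-exponent (sym y-exponent)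
    where
    x-exponent : suc i ℕ.+ x ≡ suc (d ℕ.+ l)
    x-exponent = begin
      suc i ℕ.+ x        ≡⟨ cong (ℕ._+ x) k+l≡ ⟨
      k ℕ.+ l ℕ.+ x      ≡⟨ ℕ.+-comm (k ℕ.+ l) x ⟩
      x ℕ.+ (k ℕ.+ l)    ≡⟨ ℕ.+-assoc x k l ⟨
      x ℕ.+ k ℕ.+ l      ≡⟨ cong (ℕ._+ l) x+k≡ ⟩
      suc (d ℕ.+ l)      ∎
    y-exponent : (N ℕ.+ suc r) ∸ (d ℕ.+ l) ≡ suc r ℕ.+ y
    y-exponent = begin
      (N ℕ.+ suc r) ∸ (d ℕ.+ l)
        -- Writing `N` as d + l + y exposes the subtrahend, so the truncated subtraction becomes a
        -- cancellation.
        ≡⟨ cong (λ N → (N ℕ.+ suc r) ∸ (d ℕ.+ l)) (ℕ.m+[n∸m]≡n (des-≤ π)) ⟨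
      (d ℕ.+ (N ∸ d) ℕ.+ suc r) ∸ (d ℕ.+ l)
        ≡⟨ cong (λ c → (d ℕ.+ c ℕ.+ suc r) ∸ (d ℕ.+ l)) (trans (ℕ.+-comm l y) y+l≡) ⟨
      (d ℕ.+ (l ℕ.+ y) ℕ.+ suc r) ∸ (d ℕ.+ l)
        ≡⟨ cong (λ c → (c ℕ.+ suc r) ∸ (d ℕ.+ l)) (ℕ.+-assoc d l y) ⟨
      (d ℕ.+ l ℕ.+ y ℕ.+ suc r) ∸ (d ℕ.+ l)
        ≡⟨ cong (_∸ (d ℕ.+ l)) (ℕ.+-assoc (d ℕ.+ l) y (suc r)) ⟩
      (d ℕ.+ l ℕ.+ (y ℕ.+ suc r)) ∸ (d ℕ.+ l)
        ≡⟨ ℕ.m+n∸m≡n (d ℕ.+ l) (y ℕ.+ suc r) ⟩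
      y ℕ.+ suc r
        ≡⟨ ℕ.+-comm y (suc r) ⟩
      suc r ℕ.+ y ∎

-- Multiset permutations

sum-∷ʳ : ∀ {n} (m : Vec ℕ n) r → sum (m ∷ʳ r) ≡ sum m ℕ.+ r
sum-∷ʳ []      r = ℕ.+-identityʳ r
sum-∷ʳ (x ∷ m) r = trans (cong (x ℕ.+_) (sum-∷ʳ m r)) (sym (ℕ.+-assoc x (sum m) r))

lookup-∷ʳ-fromℕ : ∀ {n} (m : Vec A n) r → lookup (m ∷ʳ r) (fromℕ n) ≡ r
lookup-∷ʳ-fromℕ []      r = refl
lookup-∷ʳ-fromℕ (x ∷ m) r = lookup-∷ʳ-fromℕ m r

lookup-∷ʳ-inject₁ : ∀ {n} (m : Vec A n) r i → lookup (m ∷ʳ r) (inject₁ i) ≡ lookup m i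
lookup-∷ʳ-inject₁ (x ∷ m) r fzero    = refl
lookup-∷ʳ-inject₁ (x ∷ m) r (fsuc i) = lookup-∷ʳ-inject₁ m r i

sum≡0⇒lookup≡0 : ∀ {n} (m : Vec ℕ n) → sum m ≡ 0 → ∀ i → lookup m i ≡ 0
sum≡0⇒lookup≡0 (x ∷ m) eq fzero    = ℕ.m+n≡0⇒m≡0 x eq
sum≡0⇒lookup≡0 (x ∷ m) eq (fsuc i) = sum≡0⇒lookup≡0 m (ℕ.m+n≡0⇒n≡0 x eq) i

-- Insertion fixes the top count at `r` and keeps all other counts, so only the condition on `π`
-- remains.
does-isPermutationOf?-∷ʳ : ∀ {n N L r} {π : Word n N} {w : Word (suc n) L} (m : Vec ℕ n) →
  Insertion π r w → does (isPermutationOf? (m ∷ʳ r) w) ≡ does (isPermutationOf? m π)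
does-isPermutationOf?-∷ʳ {n} {r = r} {π} {w} m ins =
  does-⇔ (mk⇔ to from) (isPermutationOf? (m ∷ʳ r) w) (isPermutationOf? m π)
  where
  to : IsPermutationOf (m ∷ʳ r) w → IsPermutationOf m π
  to perm i = trans (sym (count-inject₁ ins i)) (trans (perm (inject₁ i)) (lookup-∷ʳ-inject₁ m r i))
  from : IsPermutationOf m π → IsPermutationOf (m ∷ʳ r) w
  from perm i with view i
  ... | ‵fromℕ     = trans (count-top ins) (sym (lookup-∷ʳ-fromℕ m r))
  ... | ‵inject₁ j = trans (count-inject₁ ins j) (trans (perm j) (sym (lookup-∷ʳ-inject₁ m r j)))

-- Moves the multiset condition into the weight, so that the sum runs over all words and the
-- insertion recursion applies.
restrict : ∀ {n} → Vec ℕ n → Weight n → Weight n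
restrict m F w = if does (isPermutationOf? m w) then F w else 0ℚ

restrict-topSupported : ∀ {n} (m : Vec ℕ n) r (F : Weight (suc n)) →
  TopSupported r (restrict (m ∷ʳ r) F)
restrict-topSupported {n} m r F w ≢r = cong (if_then F w else 0ℚ)
  (dec-false (isPermutationOf? (m ∷ʳ r) w) (λ perm → ≢r (trans (perm (fromℕ n)) (lookup-∷ʳ-fromℕ m r))))

insertionSum-restrict : ∀ {n N} (m : Vec ℕ n) (π : Word n N) r (F : Weight (suc n)) →
  insertionSum π r (restrict (m ∷ʳ r) F) ≡ restrict m (λ π → insertionSum π r F) π
insertionSum-restrict m π r F = trans
  (insertionSum-cong π r (λ {_} {w} ins → cong (if_then F w else 0ℚ) (does-isPermutationOf?-∷ʳ m ins)))
  (push (does (isPermutationOf? m π)))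
  where
  push : ∀ t → insertionSum π r (λ w → if t then F w else 0ℚ) ≡ (if t then insertionSum π r F else 0ℚ)
  push true  = refl
  push false = insertionSum-zero π r

∑-𝔖-∷ʳ : ∀ {n} (m : Vec ℕ n) r (F : Weight (suc n)) →
  ∑ℚ (𝔖 (m ∷ʳ r)) F ≡ ∑ℚ (𝔖 m) (λ π → insertionSum π r F)
∑-𝔖-∷ʳ {n} m r F = begin
  ∑ℚ (𝔖 (m ∷ʳ r)) F
    ≡⟨ ∑-filter (isPermutationOf? (m ∷ʳ r)) (allWords (suc n) (sum (m ∷ʳ r))) F ⟩
  ∑ℚ (allWords (suc n) (sum (m ∷ʳ r))) (restrict (m ∷ʳ r) F)
    ≡⟨ cong (λ L → ∑ℚ (allWords (suc n) L) (restrict (m ∷ʳ r) F)) (sum-∷ʳ m r) ⟩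
  ∑ℚ (allWords (suc n) (sum m ℕ.+ r)) (restrict (m ∷ʳ r) F)
    ≡⟨ ∑-allWords-insertion n (sum m) r (restrict (m ∷ʳ r) F) (restrict-topSupported m r F) ⟩
  ∑ℚ (allWords n (sum m)) (λ π → insertionSum π r (restrict (m ∷ʳ r) F))
    ≡⟨ ∑-cong (allWords n (sum m)) (λ π → insertionSum-restrict m π r F) ⟩
  ∑ℚ (allWords n (sum m)) (restrict m (λ π → insertionSum π r F))
    ≡⟨ ∑-filter (isPermutationOf? m) (allWords n (sum m)) (λ π → insertionSum π r F) ⟨
  ∑ℚ (𝔖 m) (λ π → insertionSum π r F) ∎

-- Pairing with H and the conclusion

-- The convention for the empty multiset agrees with the general formula: the empty word contributes
-- x^(0+1) y^0.
ev-H : ∀ g {n} (m : Vec ℕ n) → ev g (H m) ≡ ∑ℚ (𝔖 m) (λ π → g (suc (des π)) (sum m ∸ des π))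
ev-H g {n} m = go (sum m) refl
  where
  -- Both the test and the word length depend on `sum m`; generalising it to `N` lets a match decide
  -- the test.
  go : ∀ N → sum m ≡ N →
    ev g (if does (N ≟ 0) then X
      else ∑ (filter (isPermutationOf? m) (allWords n N)) λ π → X ^ᴾ (des π ℕ.+ 1) *ᴾ Y ^ᴾ (N ∸ des π)) ≡
    ∑ℚ (filter (isPermutationOf? m) (allWords n N)) (λ π → g (suc (des π)) (N ∸ des π))
  go zero    sum≡0 = begin
    1ℚ * g 1 0 + 0ℚ
      ≡⟨ cong (_+ 0ℚ) (*-identityˡ (g 1 0)) ⟩
    g 1 0 + 0ℚ
      -- All multiplicities vanish, so the empty word passes the filter.
      ≡⟨ cong (λ t → (if t then g 1 0 else 0ℚ) + 0ℚ)
           (dec-true (isPermutationOf? m []) (λ i → sym (sum≡0⇒lookup≡0 m sum≡0 i))) ⟨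
    (if does (isPermutationOf? m []) then g 1 0 else 0ℚ) + 0ℚ
      ≡⟨ ∑-filter (isPermutationOf? m) (allWords n 0) (λ π → g (suc (des π)) (0 ∸ des π)) ⟨
    ∑ℚ (filter (isPermutationOf? m) (allWords n 0)) (λ π → g (suc (des π)) (0 ∸ des π)) ∎
  go (suc N) _     = trans (ev-∑ g S (λ π → X ^ᴾ (des π ℕ.+ 1) *ᴾ Y ^ᴾ (suc N ∸ des π)))
    (∑-cong S (λ π → trans (ev-X^*Y^ g (des π ℕ.+ 1) (suc N ∸ des π))
      (cong (λ k → g k (suc N ∸ des π)) (ℕ.+-comm (des π) 1))))
    where S = filter (isPermutationOf? m) (allWords n (suc N))

proposition1 : ∀ {n : ℕ} (m : Vec ℕ n) (r : ℕ) → 1 ≤ r → H (m ∷ʳ r) ≈ᴾ 𝒢 r (H m)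
proposition1 m (suc r) _ i j = begin
  coeff (H (m ∷ʳ suc r)) i j
    ≡⟨ coeff≡ev (H (m ∷ʳ suc r)) i j ⟩
  ev (δ i j) (H (m ∷ʳ suc r))
    ≡⟨ ev-H (δ i j) (m ∷ʳ suc r) ⟩
  ∑ℚ (𝔖 (m ∷ʳ suc r)) (λ w → δ i j (suc (des w)) (sum (m ∷ʳ suc r) ∸ des w))
    ≡⟨ cong (λ L → ∑ℚ (𝔖 (m ∷ʳ suc r)) (λ w → δ i j (suc (des w)) (L ∸ des w))) (sum-∷ʳ m (suc r)) ⟩
  ∑ℚ (𝔖 (m ∷ʳ suc r)) (λ w → δ i j (suc (des w)) ((sum m ℕ.+ suc r) ∸ des w))
    ≡⟨ ∑-𝔖-∷ʳ m (suc r) (λ w → δ i j (suc (des w)) ((sum m ℕ.+ suc r) ∸ des w)) ⟩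
  ∑ℚ (𝔖 m) (λ π → insertionSum π (suc r) (λ w → δ i j (suc (des w)) ((sum m ℕ.+ suc r) ∸ des w)))
    ≡⟨ ∑-cong (𝔖 m) (λ π → insertionSum≡𝒢ᵗ π r (δ i j)) ⟩
  ∑ℚ (𝔖 m) (λ π → 𝒢ᵗ r (δ i j) (suc (des π)) (sum m ∸ des π))
    -- Here `H m` is paired with a function other than a `δ`, which coefficients alone would not
    -- allow.
    ≡⟨ ev-H (𝒢ᵗ r (δ i j)) m ⟨
  ev (𝒢ᵗ r (δ i j)) (H m)
    ≡⟨ ev-𝒢 r (δ i j) (H m) ⟨
  ev (δ i j) (𝒢 (suc r) (H m))
    ≡⟨ coeff≡ev (𝒢 (suc r) (H m)) i j ⟨
  coeff (𝒢 (suc r) (H m)) i j ∎
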